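{- Let $M$ be a set system over a finite set $V$ and let $X \subseteq V$. Then $$M+X*X+X = M*X+X*X,$$ i.e. $((M+X)*X)+X = ((M*X)+X)*X$.
   Context: A set system over a finite set $V$ is a pair $M=(V,D)$ with $D$ a family of subsets of $V$. Operations are written postfix and associate to the left. $\oplus$ denotes symmetric difference of sets (and exclusive-or of truth values). Pivot: for $X\subseteq V$, $M*X=(V,\{Y\oplus X \mid Y\in D\})$. Loop complementation: for $j\in V$, $M+\{j\}=(V,D')$ where for all $Z\subseteq V$: if $j\in Z$, then $Z\in D'$ iff $(Z\in D)\oplus(Z\setminus\{j\}\in D)$; if $j\notin Z$, then $Z\in D'$ iff $Z\in D$. For $X=\{x_1,\dots,x_n\}\subseteq V$, $M+X$ denotes $M+\{x_1\}+\{x_2\}\cdots+\{x_n\}$ (the result does not depend on the order), with $M+\varnothing=M$. -}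

module Defs where

open import Data.Bool.Base using (Bool; T; _xor_; if_then_else_)
open import Data.Bool.Properties using (T?) renaming (_≟_ to _≟ᵇ_)
open import Data.Fin.Base using (Fin)
open import Data.Fin.Subset using (Subset; _-_)
open import Data.Fin.Subset.Properties using (_∈?_; anySubset?)
open import Data.List.Base using (List; allFin; filter; foldl)
open import Data.Nat.Base using (ℕ)
open import Data.Vec.Base using (zipWith)
open import Data.Vec.Properties using (≡-dec)
open import Relation.Binary.PropositionalEquality using (_≡_)
open import Relation.Nullary.Decidable using (does; _×-dec_)

infixl 6 _⊕_ _*_ _+₁_ _+_
infix  4 _≈_

_⊕_ : ∀ {n} → Subset n → Subset n → Subset n
_⊕_ = zipWith _xor_

-- A set system over V = Fin n. The family is given by its characteristic
-- function, just as `Subset n` represents a subset of `Fin n`.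
record SetSystem (n : ℕ) : Set where
  constructor setSystem
  field
    family : Subset n → Bool

open SetSystem public

-- Extensional equality of families; propositional equality of the
-- characteristic functions would require function extensionality.
_≈_ : ∀ {n} → SetSystem n → SetSystem n → Set
M ≈ N = ∀ Z → family M Z ≡ family N Z

-- Pivot: the family { Y ⊕ X ∣ Y ∈ D }.
_*_ : ∀ {n} → SetSystem n → Subset n → SetSystem n
M * X = setSystem λ Z →
  does (anySubset? λ Y → T? (family M Y) ×-dec ≡-dec _≟ᵇ_ Z (Y ⊕ X))

-- Loop complementation at a single element.
_+₁_ : ∀ {n} → SetSystem n → Fin n → SetSystem n
M +₁ j = setSystem λ Z →
  if does (j ∈? Z) then family M Z xor family M (Z - j) else family M Z

elements : ∀ {n} → Subset n → List (Fin n)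
elements {n} X = filter (_∈? X) (allFin n)

-- Loop complementation at the elements of X in turn. The order is
-- immaterial up to _≈_; here it is increasing.
_+_ : ∀ {n} → SetSystem n → Subset n → SetSystem n
M + X = foldl _+₁_ M (elements X)

{-# OPTIONS --safe #-}

-- Splitting a set system on V = {v} ∪ V′ into the pair (A , B) of its
-- sections of sets containing and avoiding v, and writing X = {v} ∪ X′, the
-- operations become
--   (A , B) + X = ((A △ B) + X′ , B + X′)   and   (A , B) * X = (B * X′ , A * X′).
-- For n = 1 the theorem is the braid relation in GL₂(𝔽₂); in general both
-- operations are △-linear, so induction on V applies to the sections.
module Submission where

open import Defs
open import Algebra.Bundles using (CommutativeRing)
open import Data.Bool.Base using (T; true; false; _xor_)
open import Data.Bool.Properties
  using (T?; xor-assoc; xor-comm; xor-same; xor-identityʳ; xor-∧-commutativeRing)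
  renaming (_≟_ to _≟ᵇ_)
open import Algebra.Properties.CommutativeSemigroup
  (CommutativeRing.+-commutativeSemigroup xor-∧-commutativeRing) using (interchange)
open import Data.Fin.Base using (Fin; zero; suc)
open import Data.Fin.Subset using (Subset; Side; inside; outside; _-_; ⊥)
open import Data.Fin.Subset.Properties using (_∈?_; anySubset?; p─⊥≡p)
open import Data.List.Base as List using (List; []; _∷_; allFin; filter; foldl)
open import Data.List.Properties using (map-tabulate)
open import Data.Nat.Base using (ℕ; zero; suc)
open import Data.Product.Base using (∃; _×_; _,_)
open import Data.Vec.Base using ([]; _∷_)
open import Data.Vec.Properties using (≡-dec; zipWith-assoc; zipWith-identityʳ)
open import Function.Base using (id; _∘_)
open import Function.Bundles using (mk⇔)
open import Relation.Binary.Bundles using (Setoid)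
open import Relation.Binary.PropositionalEquality
  using (_≡_; refl; sym; trans; cong; cong₂; subst; module ≡-Reasoning)
import Relation.Binary.Reasoning.Setoid as SetoidReasoning
open import Relation.Nullary.Decidable using (does; does-⇔; _×-dec_)

private
  variable
    n : ℕ

-- Sums and sections of set systems.

infixl 6 _△_

_△_ : SetSystem n → SetSystem n → SetSystem n
M △ N = setSystem λ Z → family M Z xor family N Z

section : Side → SetSystem (suc n) → SetSystem n
section z M = setSystem λ Z → family M (z ∷ Z)

≈-setoid : ℕ → Setoid _ _
≈-setoid n = record
  { Carrier       = SetSystem n
  ; _≈_           = _≈_
  ; isEquivalence = record
    { refl  = λ _ → refl
    ; sym   = λ M≈N Z → sym (M≈N Z)
    ; trans = λ M≈N N≈P Z → trans (M≈N Z) (N≈P Z)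
    }
  }

module _ {n : ℕ} where
  open Setoid (≈-setoid n) public using ()
    renaming (reflexive to ≈-reflexive; trans to ≈-trans; refl to ≈-refl)

section-ext : {M N : SetSystem (suc n)} →
  section inside M ≈ section inside N → section outside M ≈ section outside N → M ≈ N
section-ext i o (true  ∷ Z) = i Z
section-ext i o (false ∷ Z) = o Z

△-cong : {M M′ N N′ : SetSystem n} → M ≈ M′ → N ≈ N′ → M △ N ≈ M′ △ N′
△-cong M≈M′ N≈N′ Z = cong₂ _xor_ (M≈M′ Z) (N≈N′ Z)

△-comm : (M N : SetSystem n) → M △ N ≈ N △ M
△-comm M N Z = xor-comm (family M Z) (family N Z)

△-cancel : (M N : SetSystem n) → (M △ N) △ N ≈ M
△-cancel M N Z = begin
  (m xor k) xor k  ≡⟨ xor-assoc m k k ⟩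
  m xor (k xor k)  ≡⟨ cong (m xor_) (xor-same k) ⟩
  m xor false      ≡⟨ xor-identityʳ m ⟩
  m                ∎
  where
  open ≡-Reasoning
  m = family M Z
  k = family N Z

-- Pivot.

⊕-involutive : (Z X : Subset n) → (Z ⊕ X) ⊕ X ≡ Z
⊕-involutive Z X = begin
  (Z ⊕ X) ⊕ X  ≡⟨ zipWith-assoc xor-assoc Z X X ⟩
  Z ⊕ (X ⊕ X)  ≡⟨ cong (Z ⊕_) (⊕-same X) ⟩
  Z ⊕ ⊥        ≡⟨ zipWith-identityʳ xor-identityʳ Z ⟩
  Z            ∎
  where
  open ≡-Reasoning
  ⊕-same : ∀ {n} (X : Subset n) → X ⊕ X ≡ ⊥
  ⊕-same []      = refl
  ⊕-same (x ∷ X) = cong₂ _∷_ (xor-same x) (⊕-same X)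

-- Since `_⊕ X` is an involution, `Z ≡ Y ⊕ X` has the single solution `Y = Z ⊕ X`. This turns the
-- search in the definition of the pivot into one evaluation, from which the other facts about `_*_`
-- follow.
family-* : (M : SetSystem n) (X Z : Subset n) → family (M * X) Z ≡ family M (Z ⊕ X)
family-* {n} M X Z = does-⇔ (mk⇔ to from)
  (anySubset? λ Y → T? (family M Y) ×-dec ≡-dec _≟ᵇ_ Z (Y ⊕ X))
  (T? (family M (Z ⊕ X)))
  where
  to : (∃ λ (Y : Subset n) → T (family M Y) × Z ≡ Y ⊕ X) → T (family M (Z ⊕ X))
  to (Y , Y∈M , refl) = subst (T ∘ family M) (sym (⊕-involutive Y X)) Y∈M

  from : T (family M (Z ⊕ X)) → ∃ λ (Y : Subset n) → T (family M Y) × Z ≡ Y ⊕ X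
  from Z⊕X∈M = Z ⊕ X , Z⊕X∈M , sym (⊕-involutive Z X)

*-cong : {M N : SetSystem n} (X : Subset n) → M ≈ N → M * X ≈ N * X
*-cong {M = M} {N} X M≈N Z =
  trans (family-* M X Z) (trans (M≈N (Z ⊕ X)) (sym (family-* N X Z)))

*-distrib-△ : (M N : SetSystem n) (X : Subset n) → (M △ N) * X ≈ (M * X) △ (N * X)
*-distrib-△ M N X Z = trans (family-* (M △ N) X Z)
  (sym (cong₂ _xor_ (family-* M X Z) (family-* N X Z)))

section-* : (z x : Side) (M : SetSystem (suc n)) (X : Subset n) →
  section z (M * (x ∷ X)) ≈ section (z xor x) M * X
section-* z x M X Z =
  trans (family-* M (x ∷ X) (z ∷ Z)) (sym (family-* (section (z xor x) M) X Z))

-- Loop complementation and its linearity.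

+₁-cong : {M N : SetSystem n} (j : Fin n) → M ≈ N → M +₁ j ≈ N +₁ j
+₁-cong j M≈N Z with does (j ∈? Z)
... | true  = cong₂ _xor_ (M≈N Z) (M≈N (Z - j))
... | false = M≈N Z

+₁-distrib-△ : (M N : SetSystem n) (j : Fin n) → (M △ N) +₁ j ≈ (M +₁ j) △ (N +₁ j)
+₁-distrib-△ M N j Z with does (j ∈? Z)
... | true  = interchange (family M Z) (family N Z) (family M (Z - j)) (family N (Z - j))
... | false = refl

foldl-+₁-cong : {M N : SetSystem n} (js : List (Fin n)) →
  M ≈ N → foldl _+₁_ M js ≈ foldl _+₁_ N js
foldl-+₁-cong []       M≈N = M≈N
foldl-+₁-cong (j ∷ js) M≈N = foldl-+₁-cong js (+₁-cong j M≈N)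

foldl-+₁-distrib-△ : (M N : SetSystem n) (js : List (Fin n)) →
  foldl _+₁_ (M △ N) js ≈ foldl _+₁_ M js △ foldl _+₁_ N js
foldl-+₁-distrib-△ M N []       = ≈-refl
foldl-+₁-distrib-△ M N (j ∷ js) = ≈-trans
  (foldl-+₁-cong js (+₁-distrib-△ M N j))
  (foldl-+₁-distrib-△ (M +₁ j) (N +₁ j) js)

+-cong : {M N : SetSystem n} (X : Subset n) → M ≈ N → M + X ≈ N + X
+-cong X = foldl-+₁-cong (elements X)

+-distrib-△ : (M N : SetSystem n) (X : Subset n) → (M △ N) + X ≈ (M + X) △ (N + X)
+-distrib-△ M N X = foldl-+₁-distrib-△ M N (elements X)

-- Sections of a loop complementation.

filter-∈-map-suc : (x : Side) (X : Subset n) (js : List (Fin n)) →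
  filter (_∈? (x ∷ X)) (List.map suc js) ≡ List.map suc (filter (_∈? X) js)
filter-∈-map-suc x X []       = refl
filter-∈-map-suc x X (j ∷ js) with does (j ∈? X)
... | true  = cong (suc j ∷_) (filter-∈-map-suc x X js)
... | false = filter-∈-map-suc x X js

filter-∈-tabulate-suc : (x : Side) (X : Subset n) →
  filter (_∈? (x ∷ X)) (List.tabulate suc) ≡ List.map suc (elements X)
filter-∈-tabulate-suc x X = trans
  (cong (filter (_∈? (x ∷ X))) (sym (map-tabulate id suc)))
  (filter-∈-map-suc x X (allFin _))

-- Both the test `suc j ∈? (z ∷ Z)` and the removal `(z ∷ Z) - suc j` act on the tail only, so
-- `section z (M +₁ suc j)` reduces to `section z M +₁ j`. Hence propositional equality, not just
-- `_≈_`.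
section-foldl-+₁ : (z : Side) (M : SetSystem (suc n)) (js : List (Fin n)) →
  section z (foldl _+₁_ M (List.map suc js)) ≡ foldl _+₁_ (section z M) js
section-foldl-+₁ z M []       = refl
section-foldl-+₁ z M (j ∷ js) = section-foldl-+₁ z (M +₁ suc j) js

section-+-outside : (z : Side) (M : SetSystem (suc n)) (X : Subset n) →
  section z (M + (outside ∷ X)) ≈ section z M + X
section-+-outside z M X = ≈-reflexive (trans
  (cong (section z ∘ foldl _+₁_ M) (filter-∈-tabulate-suc outside X))
  (section-foldl-+₁ z M (elements X)))

-- The elements are listed in increasing order, so `zero` is complemented first and all later steps
-- stay within a section.
section-+-inside : (z : Side) (M : SetSystem (suc n)) (X : Subset n) →
  section z (M + (inside ∷ X)) ≈ section z (M +₁ zero) + X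
section-+-inside z M X = ≈-reflexive (trans
  (cong (section z ∘ foldl _+₁_ (M +₁ zero)) (filter-∈-tabulate-suc inside X))
  (section-foldl-+₁ z (M +₁ zero) (elements X)))

outside-+-inside : (M : SetSystem (suc n)) (X : Subset n) →
  section outside (M + (inside ∷ X)) ≈ section outside M + X
outside-+-inside = section-+-inside outside

inside-+-inside : (M : SetSystem (suc n)) (X : Subset n) →
  section inside (M + (inside ∷ X)) ≈ (section inside M △ section outside M) + X
inside-+-inside M X = ≈-trans (section-+-inside inside M X)
  -- Removing `zero` from `inside ∷ Z` computes to `outside ∷ (Z ─ ⊥)`, whose tail is `Z` only up to
  -- a proof.
  (+-cong X λ Z → cong (λ Y → family M (inside ∷ Z) xor family M (outside ∷ Y)) (p─⊥≡p Z))

-- Induction on the size of the ground set.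

theorem11 : ∀ (n : ℕ) (M : SetSystem n) (X : Subset n) →
    ((M + X) * X) + X ≈ ((M * X) + X) * X
-- Here `_+ []` computes away, which leaves one pivot by `[]` against two.
theorem11 zero M [] [] = sym (family-* (M * []) [] [])
theorem11 (suc n) M (false ∷ X) = section-ext (eq inside) (eq outside)
  where
  open SetoidReasoning (≈-setoid n)
  X⁰ = outside ∷ X

  section-*-outside : ∀ z N → section z (N * X⁰) ≈ section z N * X
  -- For a variable `z` the term `z xor outside` does not reduce to `z`.
  section-*-outside z N = subst (λ w → section z (N * X⁰) ≈ section w N * X)
    (xor-identityʳ z) (section-* z outside N X)

  eq : ∀ z → section z (((M + X⁰) * X⁰) + X⁰) ≈ section z (((M * X⁰) + X⁰) * X⁰)
  eq z = begin
    section z (((M + X⁰) * X⁰) + X⁰)  ≈⟨ section-+-outside z ((M + X⁰) * X⁰) X ⟩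
    section z ((M + X⁰) * X⁰) + X     ≈⟨ +-cong X (section-*-outside z (M + X⁰)) ⟩
    (section z (M + X⁰) * X) + X      ≈⟨ +-cong X (*-cong X (section-+-outside z M X)) ⟩
    ((section z M + X) * X) + X       ≈⟨ theorem11 n (section z M) X ⟩
    ((section z M * X) + X) * X       ≈⟨ *-cong X (+-cong X (section-*-outside z M)) ⟨
    (section z (M * X⁰) + X) * X      ≈⟨ *-cong X (section-+-outside z (M * X⁰) X) ⟨
    section z ((M * X⁰) + X⁰) * X     ≈⟨ section-*-outside z ((M * X⁰) + X⁰) ⟨
    section z (((M * X⁰) + X⁰) * X⁰)  ∎
-- At the head coordinate the left side takes `(A , B)` to `(A △ B , B)`, `(B , A △ B)`,
-- `(A , A △ B)`, and the right side takes it to `(B , A)`, `(A △ B , A)`, `(A , A △ B)`. So the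
-- induction hypothesis is used at `A` for `inside` and at `A △ B` for `outside`.
theorem11 (suc n) M (true ∷ X) = section-ext eq-inside eq-outside
  where
  open SetoidReasoning (≈-setoid n)
  X¹ = inside ∷ X
  A  = section inside M
  B  = section outside M

  inside-+-* : section inside ((M + X¹) * X¹) ≈ (B + X) * X
  inside-+-* = ≈-trans (section-* inside inside (M + X¹) X)
    (*-cong X (outside-+-inside M X))

  outside-+-* : section outside ((M + X¹) * X¹) ≈ ((A △ B) + X) * X
  outside-+-* = ≈-trans (section-* outside inside (M + X¹) X)
    (*-cong X (inside-+-inside M X))

  -- By linearity the sum can be taken before the operations, where the two copies of `B` cancel.
  sum-+-* : ((B + X) * X) △ (((A △ B) + X) * X) ≈ (A + X) * X
  sum-+-* = begin
    ((B + X) * X) △ (((A △ B) + X) * X)  ≈⟨ △-comm ((B + X) * X) (((A △ B) + X) * X) ⟩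
    (((A △ B) + X) * X) △ ((B + X) * X)  ≈⟨ *-distrib-△ ((A △ B) + X) (B + X) X ⟨
    (((A △ B) + X) △ (B + X)) * X        ≈⟨ *-cong X (+-distrib-△ (A △ B) B X) ⟨
    (((A △ B) △ B) + X) * X              ≈⟨ *-cong X (+-cong X (△-cancel A B)) ⟩
    (A + X) * X                          ∎

  eq-inside : section inside (((M + X¹) * X¹) + X¹) ≈ section inside (((M * X¹) + X¹) * X¹)
  eq-inside = begin
    section inside (((M + X¹) * X¹) + X¹)
      ≈⟨ inside-+-inside ((M + X¹) * X¹) X ⟩
    (section inside ((M + X¹) * X¹) △ section outside ((M + X¹) * X¹)) + X
      ≈⟨ +-cong X (△-cong inside-+-* outside-+-*) ⟩
    (((B + X) * X) △ (((A △ B) + X) * X)) + X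
      ≈⟨ +-cong X sum-+-* ⟩
    ((A + X) * X) + X
      ≈⟨ theorem11 n A X ⟩
    ((A * X) + X) * X
      ≈⟨ *-cong X (+-cong X (section-* outside inside M X)) ⟨
    (section outside (M * X¹) + X) * X
      ≈⟨ *-cong X (outside-+-inside (M * X¹) X) ⟨
    section outside ((M * X¹) + X¹) * X
      ≈⟨ section-* inside inside ((M * X¹) + X¹) X ⟨
    section inside (((M * X¹) + X¹) * X¹)
      ∎

  -- On the right side of the theorem the pivot comes first, so loop complementation adds sections
  -- already swapped; commutativity of `_△_` absorbs the swap.
  inside-△-outside-* : section inside (M * X¹) △ section outside (M * X¹) ≈ (A △ B) * X
  inside-△-outside-* = begin
    section inside (M * X¹) △ section outside (M * X¹)
      ≈⟨ △-cong (section-* inside inside M X) (section-* outside inside M X) ⟩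
    (B * X) △ (A * X)
      ≈⟨ △-comm (B * X) (A * X) ⟩
    (A * X) △ (B * X)
      ≈⟨ *-distrib-△ A B X ⟨
    (A △ B) * X
      ∎

  eq-outside : section outside (((M + X¹) * X¹) + X¹) ≈ section outside (((M * X¹) + X¹) * X¹)
  eq-outside = begin
    section outside (((M + X¹) * X¹) + X¹)
      ≈⟨ outside-+-inside ((M + X¹) * X¹) X ⟩
    section outside ((M + X¹) * X¹) + X
      ≈⟨ +-cong X outside-+-* ⟩
    (((A △ B) + X) * X) + X
      ≈⟨ theorem11 n (A △ B) X ⟩
    (((A △ B) * X) + X) * X
      ≈⟨ *-cong X (+-cong X inside-△-outside-*) ⟨
    ((section inside (M * X¹) △ section outside (M * X¹)) + X) * X
      ≈⟨ *-cong X (inside-+-inside (M * X¹) X) ⟨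
    section inside ((M * X¹) + X¹) * X
      ≈⟨ section-* outside inside ((M * X¹) + X¹) X ⟨
    section outside (((M * X¹) + X¹) * X¹)
      ∎
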